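{- Let $r$ be a positive integer and let $\mathcal{H}$ be a hereditary family with $\mu(\mathcal{H}) \geq n_{\rm S}(r,1)$. If $\mathcal{A}$ and $\mathcal{B}$ are cross-intersecting subfamilies of $\mathcal{H}^{(r)}$, then $|\mathcal{A}| + |\mathcal{B}| \leq |\mathcal{H}^{(r)}|$.
   Context: All sets and families are finite. A family $\mathcal{H}$ is hereditary if every subset of every member of $\mathcal{H}$ is a member of $\mathcal{H}$. A base of a family $\mathcal{F}$ is a set $B \in \mathcal{F}$ that is not a proper subset of any member of $\mathcal{F}$; $\mu(\mathcal{F})$ denotes the size of a smallest base of $\mathcal{F}$. $\mathcal{H}^{(r)} := \{H \in \mathcal{H} : |H| = r\}$. Families $\mathcal{A}$ and $\mathcal{B}$ are cross-intersecting if $A \cap B \neq \emptyset$ for every $A \in \mathcal{A}$ and $B \in \mathcal{B}$. Define $m(r,1) := \max\{2r, \frac{(r-1)(r+4)}{2}\}$ and $n_{\rm S}(r,1) := r\binom{m(r,1)}{2} + r$. -}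

module Defs where

open import Data.Bool using (Bool; true; false; T)
open import Data.Nat using (ℕ; zero; suc; _+_; _*_; _∸_; _≤_; _⊔_; _/_)
open import Data.Nat.Combinatorics using (_C_)
open import Data.Vec using (_∷_; [])
open import Data.List using (List; []; _∷_; _++_; map; filter; length)
open import Data.Fin.Subset using (Subset; _⊆_; _⊂_; ∣_∣; _∩_; Nonempty)
open import Data.Product using (Σ; _×_; ∃)
open import Relation.Nullary using (¬_)
open import Relation.Binary.PropositionalEquality using (_≡_)
open import Data.Bool.Properties using (T?)

-- Every finite family of finite sets lives inside the power set of some
-- finite ground set Fin n.  A family is given by its (Boolean) indicator
-- on the subsets of Fin n.
Family : ℕ → Set
Family n = Subset n → Bool

_∈F_ : ∀ {n} → Subset n → Family n → Set
X ∈F F = T (F X)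

allSubsets : (n : ℕ) → List (Subset n)
allSubsets zero = [] ∷ []
allSubsets (suc n) = map (true ∷_) (allSubsets n) ++ map (false ∷_) (allSubsets n)

∣_∣F : ∀ {n} → Family n → ℕ
∣ F ∣F = length (filter (λ X → T? (F X)) (allSubsets _))

Hereditary : ∀ {n} → Family n → Set
Hereditary F = ∀ X Y → X ∈F F → Y ⊆ X → Y ∈F F

IsBase : ∀ {n} → Family n → Subset n → Set
IsBase F B = B ∈F F × (∀ C → C ∈F F → ¬ (B ⊂ C))

IsMu : ∀ {n} → Family n → ℕ → Set
IsMu F k = (Σ _ λ B → IsBase F B × ∣ B ∣ ≡ k) × (∀ B → IsBase F B → k ≤ ∣ B ∣)

layer : ∀ {n} → Family n → ℕ → Family n
layer F r X with Data.Nat._≟_ ∣ X ∣ r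
... | Relation.Nullary.yes _ = F X
... | Relation.Nullary.no _ = false

_⊑_ : ∀ {n} → Family n → Family n → Set
A ⊑ B = ∀ X → X ∈F A → X ∈F B

CrossIntersecting : ∀ {n} → Family n → Family n → Set
CrossIntersecting A B = ∀ X Y → X ∈F A → Y ∈F B → Nonempty (X ∩ Y)

-- m(r,1) = max{2r, (r-1)(r+4)/2}   ((r-1)(r+4) is always even)
m₁ : ℕ → ℕ
m₁ r = (2 * r) ⊔ (((r ∸ 1) * (r + 4)) / 2)

nS₁ : ℕ → ℕ
nS₁ r = r * (m₁ r C 2) + r

{-# OPTIONS --safe #-}
-- Let h = |H^(r)|, let N be the size of a smallest base, and let s be the number
-- of members of H^(r) that contain a given point x.  Count the pairs (S, y) with
-- x ∈ S ∈ H^(r), y ∉ S and S - x + y ∈ H^(r).  A base above S supplies at least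
-- N - r values of y for each S, and T = S - x + y arises from at most r pairs, as
-- y ∈ T; hence s (N - r) ≤ r (h - s), that is, s N ≤ r h.  If A and B are both
-- nonempty, then A lies in the union of the r stars centred at the points of a
-- member of B, so |A| N ≤ r² h, and likewise for B.  Finally 2 r² ≤ n_S(r,1) ≤ N.
module Submission where

open import Defs
open import Data.Nat using (ℕ; zero; suc; _≤_; _+_; _*_; z≤n; s≤s; >-nonZero; _≟_)
open import Data.Nat.Properties
open import Data.Nat.Combinatorics using (_C_; nC1≡n; nCk+nC[k+1]≡[n+1]C[k+1])
open import Data.Nat.Tactic.RingSolver using (solve-∀)
open import Data.Nat.ListAction using (sum)
open import Data.Nat.ListAction.Properties using (sum-++)
open import Data.Bool using (true; false; not; T; if_then_else_)
open import Data.Bool.Properties using (T?)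
open import Data.Fin using (Fin; zero; suc)
open import Data.Fin.Properties using () renaming (_≟_ to _≟ᶠ_)
open import Data.Fin.Subset using (Subset; _∈_; _∉_; _⊆_; ∣_∣; _∩_; Nonempty)
open import Data.Fin.Subset.Induction using (⊃-wellFounded; Acc; acc)
open import Data.Fin.Subset.Properties
  using (_∈?_; _⊂?_; anySubset?; p⊂q⇒p⊆q; ⊆-trans; ⊆-refl; x∈p∩q⁻; ∩-comm)
open import Data.List using (List; []; _∷_; _++_; map; filter; length; allFin)
open import Data.List.Properties using (map-++; map-∘; map-cong; map-tabulate)
open import Data.List.Membership.Propositional using () renaming (_∈_ to _∈ˡ_)
open import Data.List.Membership.Propositional.Properties using (∈-allFin)
open import Data.List.Relation.Unary.Any using (here; there)
open import Data.Product using (Σ; ∃; _×_; _,_; proj₁; proj₂)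
open import Data.Sum using (_⊎_; inj₁; inj₂; [_,_]′)
open import Data.Vec using ([]; _∷_; here; there; updateAt)
open import Data.Vec.Properties using (updateAt-updates; updateAt-minimal; []=⇒lookup)
open import Function using (_∘_; id)
open import Level using (Level)
open import Relation.Nullary using (¬_; Dec; yes; no; does; contradiction)
open import Relation.Nullary.Decidable using (_×-dec_; ¬?; toSum)
open import Relation.Binary.PropositionalEquality
  using (_≡_; _≢_; refl; sym; trans; cong; cong₂; subst)

private
  variable
    n : ℕ
    a b p q r : Level
    A : Set a
    B : Set b
    P : Set p
    Q : Set q
    R : Set r

-- Finite sums over lists.

∑ : List A → (A → ℕ) → ℕ
∑ xs f = sum (map f xs)

∑-mono : ∀ (xs : List A) {f g : A → ℕ} → (∀ x → f x ≤ g x) → ∑ xs f ≤ ∑ xs g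
∑-mono []       f≤g = z≤n
∑-mono (x ∷ xs) f≤g = +-mono-≤ (f≤g x) (∑-mono xs f≤g)

∑-cong : ∀ (xs : List A) {f g : A → ℕ} → (∀ x → f x ≡ g x) → ∑ xs f ≡ ∑ xs g
∑-cong xs f≗g = cong sum (map-cong f≗g xs)

∈⇒≤-∑ : ∀ {x : A} {xs} (f : A → ℕ) → x ∈ˡ xs → f x ≤ ∑ xs f
∈⇒≤-∑ f (here refl)       = m≤m+n _ _
∈⇒≤-∑ f (there {x} x∈xs) = ≤-trans (∈⇒≤-∑ f x∈xs) (m≤n+m _ (f x))

∑-zero : ∀ (xs : List A) → ∑ xs (λ _ → 0) ≡ 0
∑-zero []       = refl
∑-zero (x ∷ xs) = ∑-zero xs

+-interchange : ∀ i j k l → (i + j) + (k + l) ≡ (i + k) + (j + l)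
+-interchange = solve-∀

∑-+ : ∀ (xs : List A) (f g : A → ℕ) → ∑ xs (λ x → f x + g x) ≡ ∑ xs f + ∑ xs g
∑-+ []       f g = refl
∑-+ (x ∷ xs) f g =
  trans (cong (f x + g x +_) (∑-+ xs f g)) (+-interchange (f x) (g x) (∑ xs f) (∑ xs g))

∑-* : ∀ (xs : List A) (f : A → ℕ) c → ∑ xs (λ x → f x * c) ≡ ∑ xs f * c
∑-* []       f c = refl
∑-* (x ∷ xs) f c =
  trans (cong (f x * c +_) (∑-* xs f c)) (sym (*-distribʳ-+ c (f x) (∑ xs f)))

∑-swap : ∀ (xs : List A) (ys : List B) (f : A → B → ℕ) →
  ∑ xs (λ x → ∑ ys (f x)) ≡ ∑ ys (λ y → ∑ xs (λ x → f x y))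
∑-swap []       ys f = sym (∑-zero ys)
∑-swap (x ∷ xs) ys f =
  trans (cong (∑ ys (f x) +_) (∑-swap xs ys f)) (sym (∑-+ ys (f x) _))

∑-++ : ∀ (xs ys : List A) (f : A → ℕ) → ∑ (xs ++ ys) f ≡ ∑ xs f + ∑ ys f
∑-++ xs ys f = trans (cong sum (map-++ f xs ys)) (sum-++ (map f xs) (map f ys))

∑-map : ∀ (xs : List A) (g : A → B) (f : B → ℕ) → ∑ (map g xs) f ≡ ∑ xs (f ∘ g)
∑-map xs g f = cong sum (sym (map-∘ xs))

∑-allFin : ∀ (f : Fin (suc n) → ℕ) → ∑ (allFin (suc n)) f ≡ f zero + ∑ (allFin n) (f ∘ suc)
∑-allFin f = cong (λ l → f zero + sum l) (trans (map-tabulate suc f) (sym (map-tabulate id (f ∘ suc))))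

-- Indicators of decidable propositions.

𝟙 : Dec P → ℕ
𝟙 d = if does d then 1 else 0

𝟙-mono : (p : Dec P) (q : Dec Q) → (P → Q) → 𝟙 p ≤ 𝟙 q
𝟙-mono (no _)  _       f = z≤n
𝟙-mono (yes p) (yes _) f = ≤-refl
𝟙-mono (yes p) (no ¬q) f = contradiction (f p) ¬q

𝟙-mono-+ : (p : Dec P) (q : Dec Q) (r : Dec R) → (P → Q ⊎ R) → 𝟙 p ≤ 𝟙 q + 𝟙 r
𝟙-mono-+ (no _)  _       _       f = z≤n
𝟙-mono-+ (yes p) (yes _) _       f = s≤s z≤n
𝟙-mono-+ (yes p) (no ¬q) r       f with f p
... | inj₁ q = contradiction q ¬q
... | inj₂ x = 𝟙-mono (yes x) r id

𝟙-*-mono : ∀ (p : Dec P) {k l} → (P → k ≤ l) → 𝟙 p * k ≤ 𝟙 p * l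
𝟙-*-mono (no _)  f = z≤n
𝟙-*-mono (yes p) f = *-monoʳ-≤ 1 (f p)

𝟙-split : (p : Dec P) (q : Dec Q) → 𝟙 (p ×-dec q) + 𝟙 (p ×-dec ¬? q) ≡ 𝟙 p
𝟙-split (no _)  q       = refl
𝟙-split (yes _) (yes _) = refl
𝟙-split (yes _) (no _)  = refl

-- Once `p` is decided, `does (p ×-dec q x)` reduces for every `x` at the same time, so one case
-- split takes the common factor out of the sum.
∑-𝟙-× : ∀ (xs : List A) (p : Dec P) {Q : A → Set b} (q : ∀ x → Dec (Q x)) →
  ∑ xs (λ x → 𝟙 (p ×-dec q x)) ≡ 𝟙 p * ∑ xs (λ x → 𝟙 (q x))
∑-𝟙-× xs (no _)  q = ∑-zero xs
∑-𝟙-× xs (yes _) q = sym (*-identityˡ _)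

-- Union bound for a single element: one witness already contributes 1 to the right-hand side.
𝟙-≤-∑ : ∀ (p : Dec P) {Q : Fin n → Set b} (q : ∀ y → Dec (Q y)) → (P → ∃ Q) →
  𝟙 p ≤ ∑ (allFin n) (λ y → 𝟙 (q y))
𝟙-≤-∑ (no _)      q f = z≤n
𝟙-≤-∑ p@(yes p′) q f =
  let y , Qy = f p′
  in ≤-trans (𝟙-mono p (q y) (λ _ → Qy)) (∈⇒≤-∑ (λ z → 𝟙 (q z)) (∈-allFin y))

-- Sizes as sums of indicators.

length-filter-T? : ∀ (xs : List (Subset n)) (F : Family n) →
  length (filter (λ X → T? (F X)) xs) ≡ ∑ xs (λ X → 𝟙 (T? (F X)))
length-filter-T? []       F = refl
length-filter-T? (X ∷ xs) F with F X
... | true  = cong suc (length-filter-T? xs F)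
... | false = length-filter-T? xs F

∣F∣≡∑ : ∀ (F : Family n) → ∣ F ∣F ≡ ∑ (allSubsets n) (λ X → 𝟙 (T? (F X)))
∣F∣≡∑ F = length-filter-T? (allSubsets _) F

∣p∣≡∑ : ∀ (S : Subset n) → ∣ S ∣ ≡ ∑ (allFin n) (λ y → 𝟙 (y ∈? S))
∣p∣≡∑ []          = refl
∣p∣≡∑ S@(true ∷ p)  = trans (cong suc (∣p∣≡∑ p)) (sym (∑-allFin (λ y → 𝟙 (y ∈? S))))
∣p∣≡∑ S@(false ∷ p) = trans (∣p∣≡∑ p) (sym (∑-allFin (λ y → 𝟙 (y ∈? S))))

-- Toggling and exchanging points.

toggle : Fin n → Subset n → Subset n
toggle i S = updateAt S i not

x∈p⇒x∉toggle : ∀ {i : Fin n} {S} → i ∈ S → i ∉ toggle i S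
x∈p⇒x∉toggle {i = i} {S} i∈S i∈S′
  with () ← trans (sym ([]=⇒lookup (updateAt-updates i S i∈S))) ([]=⇒lookup i∈S′)

x∉p⇒x∈toggle : ∀ {i : Fin n} {S} → i ∉ S → i ∈ toggle i S
x∉p⇒x∈toggle {i = zero}  {true ∷ S}  i∉S = contradiction here i∉S
x∉p⇒x∈toggle {i = zero}  {false ∷ S} i∉S = here
x∉p⇒x∈toggle {i = suc i} {s ∷ S}     i∉S = there (x∉p⇒x∈toggle (i∉S ∘ there))

∈-toggle⁺ : ∀ {i j : Fin n} {S} → j ≢ i → j ∈ S → j ∈ toggle i S
∈-toggle⁺ {i = i} {j} {S} j≢i j∈S = updateAt-minimal j i S j≢i j∈S

∈-toggle⁻ : ∀ {i j : Fin n} {S} → j ≢ i → j ∈ toggle i S → j ∈ S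
∈-toggle⁻ {j = j} {S} j≢i j∈S′ with j ∈? S
... | yes j∈S = j∈S
... | no  j∉S = contradiction j∈S′ (j∉ j≢i j∉S)
  where
  j∉ : ∀ {n} {i j : Fin n} {S} → j ≢ i → j ∉ S → j ∉ toggle i S
  j∉ {i = zero}  {zero}  {s ∷ S} j≢i j∉S j∈         = j≢i refl
  j∉ {i = zero}  {suc j} {s ∷ S} j≢i j∉S (there j∈) = j∉S (there j∈)
  j∉ {i = suc i} {zero}  {s ∷ S} j≢i j∉S here       = j∉S here
  j∉ {i = suc i} {suc j} {s ∷ S} j≢i j∉S (there j∈) = j∉ (j≢i ∘ cong suc) (j∉S ∘ there) j∈

x∉p⇒∣toggle∣ : ∀ {i : Fin n} {S} → i ∉ S → ∣ toggle i S ∣ ≡ suc ∣ S ∣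
x∉p⇒∣toggle∣ {i = zero}  {true ∷ S}  i∉S = contradiction here i∉S
x∉p⇒∣toggle∣ {i = zero}  {false ∷ S} i∉S = refl
x∉p⇒∣toggle∣ {i = suc i} {true ∷ S}  i∉S = cong suc (x∉p⇒∣toggle∣ (i∉S ∘ there))
x∉p⇒∣toggle∣ {i = suc i} {false ∷ S} i∉S = x∉p⇒∣toggle∣ (i∉S ∘ there)

x∈p⇒∣toggle∣ : ∀ {i : Fin n} {S} → i ∈ S → suc ∣ toggle i S ∣ ≡ ∣ S ∣
x∈p⇒∣toggle∣ here                        = refl
x∈p⇒∣toggle∣ {S = true ∷ S}  (there i∈S) = cong suc (x∈p⇒∣toggle∣ i∈S)
x∈p⇒∣toggle∣ {S = false ∷ S} (there i∈S) = x∈p⇒∣toggle∣ i∈S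

∑-allSubsets : ∀ (f : Subset (suc n) → ℕ) →
  ∑ (allSubsets (suc n)) f ≡
  ∑ (allSubsets n) (f ∘ (true ∷_)) + ∑ (allSubsets n) (f ∘ (false ∷_))
∑-allSubsets {n} f = trans (∑-++ (map (true ∷_) (allSubsets n)) (map (false ∷_) (allSubsets n)) f)
  (cong₂ _+_ (∑-map (allSubsets n) (true ∷_) f) (∑-map (allSubsets n) (false ∷_) f))

-- Toggling is a bijection of the whole power set, whether it adds or deletes `i`. At coordinate
-- `zero` it swaps the two halves of `allSubsets`; at a later coordinate it acts within each half.
∑-toggle : ∀ (i : Fin n) (f : Subset n → ℕ) →
  ∑ (allSubsets n) (f ∘ toggle i) ≡ ∑ (allSubsets n) f
∑-toggle {suc n} zero f =
  trans (∑-allSubsets (f ∘ toggle zero)) (trans (+-comm (∑ (allSubsets n) _) _) (sym (∑-allSubsets f)))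
∑-toggle (suc i) f =
  trans (∑-allSubsets (f ∘ toggle (suc i)))
    (trans (cong₂ _+_ (∑-toggle i (f ∘ (true ∷_))) (∑-toggle i (f ∘ (false ∷_))))
           (sym (∑-allSubsets f)))

-- When x ∈ S and y ∉ S this is S - x + y.
exchange : Fin n → Fin n → Subset n → Subset n
exchange x y S = toggle x (toggle y S)

-- This takes the place of an injectivity argument for S ↦ S - x + y with `x` and `y` fixed.
∑-exchange : ∀ (x y : Fin n) (f : Subset n → ℕ) →
  ∑ (allSubsets n) (f ∘ exchange x y) ≡ ∑ (allSubsets n) f
∑-exchange x y f = trans (∑-toggle y (f ∘ toggle x)) (∑-toggle x f)

module _ {x y : Fin n} {S : Subset n} where

  x∉exchange : x ∈ S → y ∉ S → x ∉ exchange x y S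
  x∉exchange x∈S y∉S = x∈p⇒x∉toggle (∈-toggle⁺ (λ { refl → y∉S x∈S }) x∈S)

  y∈exchange : x ∈ S → y ∉ S → y ∈ exchange x y S
  y∈exchange x∈S y∉S = ∈-toggle⁺ (λ { refl → y∉S x∈S }) (x∉p⇒x∈toggle y∉S)

  ∣exchange∣ : x ∈ S → y ∉ S → ∣ exchange x y S ∣ ≡ ∣ S ∣
  ∣exchange∣ x∈S y∉S = suc-injective
    (trans (x∈p⇒∣toggle∣ (∈-toggle⁺ (λ { refl → y∉S x∈S }) x∈S)) (x∉p⇒∣toggle∣ y∉S))

  -- For `C` a base above `S`, heredity then puts S - x + y into the family.
  exchange-⊆ : ∀ {C} → x ∈ S → y ∉ S → S ⊆ C → y ∈ C → exchange x y S ⊆ C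
  exchange-⊆ x∈S y∉S S⊆C y∈C {z} z∈ with z ≟ᶠ x | z ≟ᶠ y
  ... | yes refl | _        = contradiction z∈ (x∉exchange x∈S y∉S)
  ... | no _     | yes refl = y∈C
  ... | no z≢x   | no z≢y   = S⊆C (∈-toggle⁻ z≢y (∈-toggle⁻ z≢x z∈))

-- Layers and bases.

∈-layer⁺ : ∀ {F : Family n} {r X} → X ∈F F → ∣ X ∣ ≡ r → X ∈F layer F r
∈-layer⁺ {r = r} {X} X∈F ∣X∣≡r with ∣ X ∣ ≟ r
... | yes _ = X∈F
... | no ≢r = contradiction ∣X∣≡r ≢r

∈-layer⁻ : ∀ (F : Family n) r X → X ∈F layer F r → X ∈F F × ∣ X ∣ ≡ r
∈-layer⁻ F r X X∈L with ∣ X ∣ ≟ r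
... | yes ∣X∣≡r = X∈L , ∣X∣≡r

-- Climb to a strictly larger member while there is one; this stops because strict inclusion is well
-- founded upwards on subsets of a finite set.
base-above : ∀ (F : Family n) {S} → S ∈F F → ∃ λ C → IsBase F C × S ⊆ C
base-above F {S} = go (⊃-wellFounded S)
  where
  go : ∀ {S} → Acc _ S → S ∈F F → ∃ λ C → IsBase F C × S ⊆ C
  go {S} (acc rec) S∈F with anySubset? (λ C → T? (F C) ×-dec (S ⊂? C))
  ... | no maximal = S , (S∈F , λ C C∈F S⊂C → maximal (C , C∈F , S⊂C)) , ⊆-refl
  ... | yes (C , C∈F , S⊂C) with go (rec S⊂C) C∈F
  ...   | E , base , C⊆E = E , base , ⊆-trans (p⊂q⇒p⊆q S⊂C) C⊆E

-- Star sizes by double counting, and families meeting a fixed set.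

starSize : Family n → Fin n → ℕ
starSize {n} F x = ∑ (allSubsets n) (λ X → 𝟙 (T? (F X) ×-dec (x ∈? X)))

module _ {n} (H : Family n) (hereditary : Hereditary H) (r N : ℕ)
         (N≤base : ∀ D → IsBase H D → N ≤ ∣ D ∣) where

  private
    L : Family n
    L = layer H r

    Ω : List (Subset n)
    Ω = allSubsets n

    module _ (x : Fin n) where

      in? out? : (S : Subset n) → Dec _
      in?  S = T? (L S) ×-dec (x ∈? S)
      out? S = T? (L S) ×-dec ¬? (x ∈? S)

      -- The edges of a bipartite graph from the members of `L` through `x` to those avoiding `x`;
      -- `y` labels the edge from S to S - x + y.
      move? : (S : Subset n) (y : Fin n) → Dec _
      move? S y = in? S ×-dec ¬? (y ∈? S) ×-dec T? (L (exchange x y S))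

      -- Here `S` is the far end T of an edge. Of the edge only x ∉ T ∈ L and y ∈ T are kept, which
      -- leaves at most `r` labels for each T.
      preimage? : (y : Fin n) (S : Subset n) → Dec _
      preimage? y S = out? S ×-dec (y ∈? S)

      -- At least N - r edges leave each `S` through `x`; the term `r` stands on the right to avoid
      -- truncated subtraction. A base `D` above `S` has at least `N` points, `r` of them in `S`,
      -- and each of the others labels an edge.
      neighbours≥ : ∀ S → 𝟙 (in? S) * N ≤ 𝟙 (in? S) * r + ∑ (allFin n) (λ y → 𝟙 (move? S y))
      neighbours≥ S = begin
        𝟙 (in? S) * N
          ≤⟨ 𝟙-*-mono (in? S) bound ⟩
        𝟙 (in? S) * (r + ∑ (allFin n) (λ y → 𝟙 (target? y)))
          ≡⟨ *-distribˡ-+ (𝟙 (in? S)) r _ ⟩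
        𝟙 (in? S) * r + 𝟙 (in? S) * ∑ (allFin n) (λ y → 𝟙 (target? y))
          ≡⟨ cong (𝟙 (in? S) * r +_) (∑-𝟙-× (allFin n) (in? S) target?) ⟨
        𝟙 (in? S) * r + ∑ (allFin n) (λ y → 𝟙 (move? S y)) ∎
        where
        open ≤-Reasoning

        -- What is left of `move? S y` once the factor `in? S`, independent of `y`, is taken out.
        target? : (y : Fin n) → Dec _
        target? y = ¬? (y ∈? S) ×-dec T? (L (exchange x y S))

        bound : T (L S) × x ∈ S → N ≤ r + ∑ (allFin n) (λ y → 𝟙 (target? y))
        bound (S∈L , x∈S) =
          let S∈H , ∣S∣≡r = ∈-layer⁻ H r S S∈L
              D , base , S⊆D = base-above H S∈H
              S-x+y∈L : ∀ {y} → y ∈ D → y ∉ S → T (L (exchange x y S))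
              S-x+y∈L y∈D y∉S = ∈-layer⁺ {F = H}
                (hereditary D _ (proj₁ base) (exchange-⊆ x∈S y∉S S⊆D y∈D))
                (trans (∣exchange∣ x∈S y∉S) ∣S∣≡r)
              split : ∀ y → y ∈ D → y ∈ S ⊎ (y ∉ S × T (L (exchange x y S)))
              split y y∈D = [ inj₁ , (λ y∉S → inj₂ (y∉S , S-x+y∈L y∈D y∉S)) ]′ (toSum (y ∈? S))
          in begin
            N                                                ≤⟨ N≤base D base ⟩
            ∣ D ∣                                            ≡⟨ ∣p∣≡∑ D ⟩
            ∑ (allFin n) (λ y → 𝟙 (y ∈? D))
              ≤⟨ ∑-mono (allFin n) (λ y → 𝟙-mono-+ (y ∈? D) (y ∈? S) (target? y) (split y)) ⟩
            ∑ (allFin n) (λ y → 𝟙 (y ∈? S) + 𝟙 (target? y))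
              ≡⟨ ∑-+ (allFin n) _ _ ⟩
            ∑ (allFin n) (λ y → 𝟙 (y ∈? S)) + ∑ (allFin n) (λ y → 𝟙 (target? y))
              ≡⟨ cong (_+ ∑ (allFin n) (λ y → 𝟙 (target? y))) (trans (sym (∣p∣≡∑ S)) ∣S∣≡r) ⟩
            r + ∑ (allFin n) (λ y → 𝟙 (target? y)) ∎

      move⇒preimage : ∀ y S → 𝟙 (move? S y) ≤ 𝟙 (preimage? y (exchange x y S))
      move⇒preimage y S = 𝟙-mono (move? S y) (preimage? y _)
        λ ((_ , x∈S) , y∉S , S′∈L) → (S′∈L , x∉exchange x∈S y∉S) , y∈exchange x∈S y∉S

      preimages≤ : ∀ S → ∑ (allFin n) (λ y → 𝟙 (preimage? y S)) ≤ 𝟙 (out? S) * r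
      preimages≤ S = begin
        ∑ (allFin n) (λ y → 𝟙 (preimage? y S))        ≡⟨ ∑-𝟙-× (allFin n) (out? S) (_∈? S) ⟩
        𝟙 (out? S) * ∑ (allFin n) (λ y → 𝟙 (y ∈? S))  ≡⟨ cong (𝟙 (out? S) *_) (∣p∣≡∑ S) ⟨
        𝟙 (out? S) * ∣ S ∣
          ≤⟨ 𝟙-*-mono (out? S) (λ (S∈L , _) → ≤-reflexive (proj₂ (∈-layer⁻ H r S S∈L))) ⟩
        𝟙 (out? S) * r                                 ∎
        where open ≤-Reasoning

      -- Reindexing by `exchange` works for one `y` at a time, so the sum over `y` is moved outside
      -- for it and then back inside, to count labels at each far end.
      moves≤ : ∑ Ω (λ S → ∑ (allFin n) (λ y → 𝟙 (move? S y))) ≤ ∑ Ω (λ S → 𝟙 (out? S)) * r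
      moves≤ = begin
        ∑ Ω (λ S → ∑ (allFin n) (λ y → 𝟙 (move? S y)))
          ≡⟨ ∑-swap Ω (allFin n) _ ⟩
        ∑ (allFin n) (λ y → ∑ Ω (λ S → 𝟙 (move? S y)))
          ≤⟨ ∑-mono (allFin n) (λ y → ∑-mono Ω (move⇒preimage y)) ⟩
        ∑ (allFin n) (λ y → ∑ Ω (λ S → 𝟙 (preimage? y (exchange x y S))))
          ≡⟨ ∑-cong (allFin n) (λ y → ∑-exchange x y (λ S → 𝟙 (preimage? y S))) ⟩
        ∑ (allFin n) (λ y → ∑ Ω (λ S → 𝟙 (preimage? y S)))
          ≡⟨ ∑-swap Ω (allFin n) _ ⟨
        ∑ Ω (λ S → ∑ (allFin n) (λ y → 𝟙 (preimage? y S)))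
          ≤⟨ ∑-mono Ω preimages≤ ⟩
        ∑ Ω (λ S → 𝟙 (out? S) * r)
          ≡⟨ ∑-* Ω _ r ⟩
        ∑ Ω (λ S → 𝟙 (out? S)) * r ∎
        where open ≤-Reasoning

  -- With s members of `L` through `x` and h - s avoiding it, the lower and upper counts of edges
  -- combine to s N ≤ s r + (h - s) r = h r.
  starSize-bound : ∀ x → starSize L x * N ≤ ∣ L ∣F * r
  starSize-bound x = begin
    starSize L x * N
      ≡⟨ ∑-* Ω _ N ⟨
    ∑ Ω (λ S → 𝟙 (in? x S) * N)
      ≤⟨ ∑-mono Ω (neighbours≥ x) ⟩
    ∑ Ω (λ S → 𝟙 (in? x S) * r + ∑ (allFin n) (λ y → 𝟙 (move? x S y)))
      ≡⟨ ∑-+ Ω _ _ ⟩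
    ∑ Ω (λ S → 𝟙 (in? x S) * r) + ∑ Ω (λ S → ∑ (allFin n) (λ y → 𝟙 (move? x S y)))
      ≤⟨ +-mono-≤ (≤-reflexive (∑-* Ω _ r)) (moves≤ x) ⟩
    ∑ Ω (λ S → 𝟙 (in? x S)) * r + ∑ Ω (λ S → 𝟙 (out? x S)) * r
      ≡⟨ *-distribʳ-+ r (∑ Ω (λ S → 𝟙 (in? x S))) _ ⟨
    (∑ Ω (λ S → 𝟙 (in? x S)) + ∑ Ω (λ S → 𝟙 (out? x S))) * r
      ≡⟨ cong (_* r) (∑-+ Ω _ _) ⟨
    ∑ Ω (λ S → 𝟙 (in? x S) + 𝟙 (out? x S)) * r
      ≡⟨ cong (_* r) (∑-cong Ω (λ S → 𝟙-split (T? (L S)) (x ∈? S))) ⟩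
    ∑ Ω (λ S → 𝟙 (T? (L S))) * r
      ≡⟨ cong (_* r) (∣F∣≡∑ L) ⟨
    ∣ L ∣F * r ∎
    where open ≤-Reasoning

  -- The stars of `L` centred at the `r` points of `Y` cover `F`, and `starSize-bound` applies to
  -- each of them.
  meets-layer-bound : ∀ (F : Family n) {Y} → F ⊑ L → Y ∈F L →
    (∀ X → X ∈F F → Nonempty (X ∩ Y)) → ∣ F ∣F * N ≤ r * (∣ L ∣F * r)
  meets-layer-bound F {Y} F⊑L Y∈L meets = begin
    ∣ F ∣F * N
      ≡⟨ cong (_* N) (∣F∣≡∑ F) ⟩
    ∑ Ω (λ X → 𝟙 (T? (F X))) * N
      ≤⟨ *-monoˡ-≤ N (∑-mono Ω (λ X → 𝟙-≤-∑ (T? (F X)) (λ y → y∈Y∩X? y X) (witness X))) ⟩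
    ∑ Ω (λ X → ∑ (allFin n) (λ y → 𝟙 (y∈Y∩X? y X))) * N
      ≡⟨ cong (_* N) (∑-swap Ω (allFin n) _) ⟩
    ∑ (allFin n) (λ y → ∑ Ω (λ X → 𝟙 (y∈Y∩X? y X))) * N
      ≡⟨ cong (_* N) (∑-cong (allFin n) (λ y → ∑-𝟙-× Ω (y ∈? Y) (in? y))) ⟩
    ∑ (allFin n) (λ y → 𝟙 (y ∈? Y) * starSize L y) * N
      ≡⟨ ∑-* (allFin n) _ N ⟨
    ∑ (allFin n) (λ y → 𝟙 (y ∈? Y) * starSize L y * N)
      ≤⟨ ∑-mono (allFin n) (λ y → ≤-trans (≤-reflexive (*-assoc (𝟙 (y ∈? Y)) _ N))
                                          (*-monoʳ-≤ (𝟙 (y ∈? Y)) (starSize-bound y))) ⟩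
    ∑ (allFin n) (λ y → 𝟙 (y ∈? Y) * (∣ L ∣F * r))
      ≡⟨ ∑-* (allFin n) _ (∣ L ∣F * r) ⟩
    ∑ (allFin n) (λ y → 𝟙 (y ∈? Y)) * (∣ L ∣F * r)
      ≡⟨ cong (_* (∣ L ∣F * r)) (∣p∣≡∑ Y) ⟨
    ∣ Y ∣ * (∣ L ∣F * r)
      ≡⟨ cong (_* (∣ L ∣F * r)) (proj₂ (∈-layer⁻ H r Y Y∈L)) ⟩
    r * (∣ L ∣F * r) ∎
    where
    open ≤-Reasoning

    -- The condition on `Y` comes first: it does not involve `X`, so it factors out of the sum over
    -- `X` and leaves exactly `starSize L y`.
    y∈Y∩X? : (y : Fin n) (X : Subset n) → Dec _
    y∈Y∩X? y X = (y ∈? Y) ×-dec (T? (L X) ×-dec (y ∈? X))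

    witness : ∀ X → X ∈F F → ∃ λ y → y ∈ Y × (X ∈F L × y ∈ X)
    witness X X∈F = let y , y∈X∩Y = meets X X∈F
                        y∈X , y∈Y = x∈p∩q⁻ X Y y∈X∩Y
                    in y , y∈Y , F⊑L X X∈F , y∈X

-- Comparison of sizes and the numerical estimate.

∣F∣-mono : ∀ {F G : Family n} → F ⊑ G → ∣ F ∣F ≤ ∣ G ∣F
∣F∣-mono {n} {F} {G} F⊑G = begin
  ∣ F ∣F                                  ≡⟨ ∣F∣≡∑ F ⟩
  ∑ (allSubsets n) (λ X → 𝟙 (T? (F X)))
    ≤⟨ ∑-mono (allSubsets n) (λ X → 𝟙-mono (T? (F X)) (T? (G X)) (F⊑G X)) ⟩
  ∑ (allSubsets n) (λ X → 𝟙 (T? (G X)))   ≡⟨ ∣F∣≡∑ G ⟨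
  ∣ G ∣F                                  ∎
  where open ≤-Reasoning

empty⇒∣F∣≡0 : ∀ {F : Family n} → ¬ (∃ λ X → X ∈F F) → ∣ F ∣F ≡ 0
empty⇒∣F∣≡0 {n} {F} empty = n≤0⇒n≡0 (begin
  ∣ F ∣F                                  ≡⟨ ∣F∣≡∑ F ⟩
  ∑ (allSubsets n) (λ X → 𝟙 (T? (F X)))
    -- `no (λ ())` decides the empty type, whose indicator is 0.
    ≤⟨ ∑-mono (allSubsets n) (λ X → 𝟙-mono (T? (F X)) (no (λ ())) (λ X∈F → empty (X , X∈F))) ⟩
  ∑ (allSubsets n) (λ _ → 0)              ≡⟨ ∑-zero (allSubsets n) ⟩
  0                                       ∎)
  where open ≤-Reasoning

-- Pascal's rule makes n C 1 = n a summand of `suc n C 2`.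
n≤1+nC2 : ∀ n → n ≤ suc (n C 2)
n≤1+nC2 zero    = z≤n
n≤1+nC2 (suc n) = s≤s (begin
  n              ≡⟨ nC1≡n n ⟨
  n C 1          ≤⟨ m≤m+n (n C 1) (n C 2) ⟩
  n C 1 + n C 2  ≡⟨ nCk+nC[k+1]≡[n+1]C[k+1] n 1 ⟩
  suc n C 2      ∎)
  where open ≤-Reasoning

-- With m = `m₁ r` ≥ 2r, one has 2r² ≤ r m ≤ r (1 + m C 2), and the last term is `nS₁ r`.
2r²≤nS₁ : ∀ r → r * (2 * r) ≤ nS₁ r
2r²≤nS₁ r = begin
  r * (2 * r)           ≤⟨ *-monoʳ-≤ r (≤-trans (m≤m⊔n (2 * r) _) (n≤1+nC2 (m₁ r))) ⟩
  r * suc (m₁ r C 2)    ≡⟨ *-suc r (m₁ r C 2) ⟩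
  r + r * (m₁ r C 2)    ≡⟨ +-comm r _ ⟩
  nS₁ r                 ∎
  where open ≤-Reasoning

2[r*hr]≡h*2r² : ∀ r h → r * (h * r) + r * (h * r) ≡ h * (r * (2 * r))
2[r*hr]≡h*2r² = solve-∀

theorem2p9 : (n r : ℕ) → 1 ≤ r → (H : Family n) → Hereditary H →
    Σ ℕ (λ k → IsMu H k × nS₁ r ≤ k) →
    (A B : Family n) → A ⊑ layer H r → B ⊑ layer H r → CrossIntersecting A B →
    ∣ A ∣F + ∣ B ∣F ≤ ∣ layer H r ∣F
theorem2p9 n r 1≤r H hereditary (N , (_ , N≤base) , nS₁≤N) A B A⊑L B⊑L cross
  with anySubset? (λ X → T? (A X)) | anySubset? (λ X → T? (B X))
-- If one family is empty, the sum is the size of the other, a subfamily of the layer.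
... | no A-empty | _ =
  ≤-trans (≤-reflexive (cong (_+ ∣ B ∣F) (empty⇒∣F∣≡0 A-empty))) (∣F∣-mono B⊑L)
... | yes _ | no B-empty =
  ≤-trans (≤-reflexive (trans (cong (∣ A ∣F +_) (empty⇒∣F∣≡0 B-empty)) (+-identityʳ _))) (∣F∣-mono A⊑L)
... | yes (X₀ , X₀∈A) | yes (Y₀ , Y₀∈B) =
  -- Both sides are compared after multiplication by `N`: the left one is at most 2r² times the size
  -- of `L`, and 2r² ≤ N.
  *-cancelʳ-≤ (∣ A ∣F + ∣ B ∣F) ∣ L ∣F N {{>-nonZero 0<N}} (begin
    (∣ A ∣F + ∣ B ∣F) * N                    ≡⟨ *-distribʳ-+ N ∣ A ∣F ∣ B ∣F ⟩
    ∣ A ∣F * N + ∣ B ∣F * N                  ≤⟨ +-mono-≤ A-bound B-bound ⟩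
    r * (∣ L ∣F * r) + r * (∣ L ∣F * r)      ≡⟨ 2[r*hr]≡h*2r² r ∣ L ∣F ⟩
    ∣ L ∣F * (r * (2 * r))                   ≤⟨ *-monoʳ-≤ ∣ L ∣F (≤-trans (2r²≤nS₁ r) nS₁≤N) ⟩
    ∣ L ∣F * N                               ∎)
  where
  open ≤-Reasoning

  L : Family n
  L = layer H r

  0<N : 1 ≤ N
  -- Positivity comes from the separate summand `r` of `nS₁ r`.
  0<N = ≤-trans (≤-trans 1≤r (m≤n+m r (r * (m₁ r C 2)))) nS₁≤N

  A-bound : ∣ A ∣F * N ≤ r * (∣ L ∣F * r)
  -- Any one member of the opposite family can serve as the fixed set met by all of `A`.
  A-bound = meets-layer-bound H hereditary r N N≤base A A⊑L (B⊑L Y₀ Y₀∈B)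
    λ X X∈A → cross X Y₀ X∈A Y₀∈B

  B-bound : ∣ B ∣F * N ≤ r * (∣ L ∣F * r)
  B-bound = meets-layer-bound H hereditary r N N≤base B B⊑L (A⊑L X₀ X₀∈A)
    λ Y Y∈B → subst Nonempty (∩-comm X₀ Y) (cross X₀ Y X₀∈A Y∈B)
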